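{- Simple $3$-$(21,7,15m)$ designs exist for every $m\in\{2,3,\ldots,102\}$.
   Context: A $t$-$(v,k,\lambda)$ design consists of a $v$-element set $P$ of points together with a collection $B$ of $k$-element subsets of $P$ (called blocks) such that every $t$-element subset of $P$ is contained in exactly $\lambda$ blocks. The design is simple if $B$ is a set, i.e. contains no repeated blocks. -}

module Defs where

open import Data.Nat using (ℕ)
open import Data.List using (List; length; filter)
open import Data.List.Relation.Unary.All using (All)
open import Data.List.Relation.Unary.Unique.Propositional using (Unique)
open import Data.Fin.Subset using (Subset; _⊆_; ∣_∣)
open import Data.Fin.Subset.Properties using (_⊆?_)
open import Data.Product using (_×_; Σ)
open import Relation.Binary.PropositionalEquality using (_≡_)

-- Point set: Fin v.  Blocks: a list of subsets of Fin v (a list, so that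
-- repeated blocks are a priori allowed; simplicity = no repetitions).

blocksContaining : {v : ℕ} → Subset v → List (Subset v) → ℕ
blocksContaining T B = length (filter (λ b → T ⊆? b) B)

IsDesign : (t v k λ′ : ℕ) → List (Subset v) → Set
IsDesign t v k λ′ B =
  All (λ b → ∣ b ∣ ≡ k) B ×
  ((T : Subset v) → ∣ T ∣ ≡ t → blocksContaining T B ≡ λ′)

IsSimpleDesign : (t v k λ′ : ℕ) → List (Subset v) → Set
IsSimpleDesign t v k λ′ B = IsDesign t v k λ′ B × Unique B

SimpleDesignExists : (t v k λ′ : ℕ) → Set
SimpleDesignExists t v k λ′ = Σ (List (Subset v)) (IsSimpleDesign t v k λ′)

{-# OPTIONS --safe #-}
module Submission where

-- The points are two fixed points together with ℤ/19.  It suffices to find pairwise disjoint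
-- designs with λ = 30, 30, 45, 90, 135, 270, 540, 540, since every 15m with 2 ≤ m ≤ 102 is a sum of
-- some of these numbers.  Each of the eight designs is invariant under swapping the fixed points
-- and under x ↦ cx + j on ℤ/19, where c ranges over the powers of 8 (first two designs; the second
-- is twice the first) or over all units.  By cyclic invariance only the triples that contain
-- 0 ∈ ℤ/19 have to be counted; this and the disjointness are checked by computation.

open import Defs
open import Data.Bool using (Bool; true; false; _∧_; T)
open import Data.Bool.ListAction using (all; any)
open import Data.Bool.Properties using (T-∧; T-≡)
open import Data.Fin using (toℕ)
open import Data.Fin.Subset using (Subset; Side; inside; outside; ∣_∣)
open import Data.Fin.Subset.Properties using (_⊆?_)
open import Data.List using (List; []; _∷_; _++_; map; concat; concatMap; iterate; length; filter)
open import Data.List.Membership.DecPropositional using (_∈?_)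
open import Data.List.Membership.Propositional using (_∈_)
open import Data.List.Membership.Propositional.Properties using (∈-++⁻; ∈-map⁻)
open import Data.List.Properties using (filter-++; length-++; length-map)
open import Data.List.Relation.Binary.Sublist.Propositional using ([]; _∷_; ⊆-refl) renaming (_⊆_ to _⊑_; _∷ʳ_ to skip)
open import Data.List.Relation.Binary.Sublist.Propositional.Properties using (++⁺; ++⁺ˡ; All-resp-⊆)
open import Data.List.Relation.Unary.All as All using (All; []; _∷_)
import Data.List.Relation.Unary.All.Properties as All
open import Data.List.Relation.Unary.AllPairs using (AllPairs; []; _∷_)
open import Data.List.Relation.Unary.Any using (here)
open import Data.List.Relation.Unary.Unique.Propositional using (Unique)
open import Data.Nat using (ℕ; zero; suc; _+_; _*_; _%_; _≤_; _<_; _≡ᵇ_; _≟_; _≤?_; s≤s)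
open import Data.Nat.Properties using (≡ᵇ⇒≡; +-comm; ≤-refl; suc-injective; 0≢1+n; allUpTo?)
open import Data.Product using (_×_; _,_; ∃-syntax; proj₁; proj₂)
open import Data.Sum using (inj₁; inj₂)
open import Data.Vec using ([]; _∷_; _∷ʳ_; tabulate; tail)
open import Data.Vec.Properties using (∷-injectiveʳ)
open import Function using (_∘_; Equivalence)
open import Level using (0ℓ)
open import Relation.Binary using (Rel)
open import Relation.Binary.PropositionalEquality using (_≡_; _≢_; refl; sym; trans; cong; cong₂; subst; module ≡-Reasoning)
open import Relation.Nullary using (does; contradiction)
open import Relation.Nullary.Decidable using (from-yes; _→-dec_)

open ≡-Reasoning

private
  variable
    n : ℕ
    A : Set

∧-split : {x y : Bool} → T (x ∧ y) → T x × T y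
∧-split = Equivalence.to T-∧

-- Tests by recursion on the coordinates

link : List (Subset (suc n)) → List (Subset n)
link []                  = []
link ((inside  ∷ b) ∷ B) = b ∷ link B
link ((outside ∷ b) ∷ B) = link B

deletion : List (Subset (suc n)) → List (Subset n)
deletion []                  = []
deletion ((inside  ∷ b) ∷ B) = deletion B
deletion ((outside ∷ b) ∷ B) = b ∷ deletion B

blocksContaining-inside : (S : Subset n) (B : List (Subset (suc n))) →
  blocksContaining (inside ∷ S) B ≡ blocksContaining S (link B)
blocksContaining-inside S []                  = refl
blocksContaining-inside S ((outside ∷ b) ∷ B) = blocksContaining-inside S B
blocksContaining-inside S ((inside  ∷ b) ∷ B) with ih ← blocksContaining-inside S B | does (S ⊆? b)
... | true  = cong suc ih
... | false = ih

blocksContaining-outside : (S : Subset n) (B : List (Subset (suc n))) →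
  blocksContaining (outside ∷ S) B ≡ blocksContaining S (map tail B)
blocksContaining-outside S []            = refl
blocksContaining-outside S ((_ ∷ b) ∷ B) with ih ← blocksContaining-outside S B | does (S ⊆? b)
... | true  = cong suc ih
... | false = ih

blocksContaining-∅ : (S : Subset n) → ∣ S ∣ ≡ 0 → (B : List (Subset n)) → blocksContaining S B ≡ length B
blocksContaining-∅ []            _  []       = refl
blocksContaining-∅ []            _  ([] ∷ B) = cong suc (blocksContaining-∅ [] refl B)
blocksContaining-∅ (outside ∷ S) eq B        =
  trans (blocksContaining-outside S B) (trans (blocksContaining-∅ S eq (map tail B)) (length-map tail B))

-- A set containing the first point is counted in the link. For a set avoiding it every block stays
-- in play, so the first coordinate is dropped from all of them. Each list obtained this way serves
-- all sets with the same initial coordinates, and once no points remain to be chosen every block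
-- left counts.
covers : (n t l : ℕ) → List (Subset n) → Bool
covers n       zero    l B = length B ≡ᵇ l
-- An empty point set has no nonempty subsets, so nothing remains to be tested.
covers zero    (suc t) l B = true
covers (suc n) (suc t) l B = covers n t l (link B) ∧ covers n (suc t) l (map tail B)

covers-sound : ∀ n t l (B : List (Subset n)) → T (covers n t l B) →
  ∀ S → ∣ S ∣ ≡ t → blocksContaining S B ≡ l
covers-sound n       zero    l B p S             eq   =
  trans (blocksContaining-∅ S eq B) (≡ᵇ⇒≡ (length B) l p)
covers-sound (suc n) (suc t) l B p (inside  ∷ S) refl =
  trans (blocksContaining-inside S B) (covers-sound n t l (link B) (proj₁ (∧-split p)) S refl)
covers-sound (suc n) (suc t) l B p (outside ∷ S) eq   =
  trans (blocksContaining-outside S B)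
    (covers-sound n (suc t) l (map tail B) (proj₂ (∧-split {covers n t l (link B)} p)) S eq)

-- Works like a radix sort: blocks are split by their first coordinate until each class has at most
-- one member, which avoids comparing all pairs.
distinct : (n : ℕ) → List (Subset n) → Bool
distinct n       []          = true
distinct n       (b ∷ [])    = true
-- Two blocks never separated by any coordinate are equal.
distinct zero    (b ∷ c ∷ B) = false
distinct (suc n) B           = distinct n (link B) ∧ distinct n (deletion B)

inside-≢ : (b : Subset n) (B : List (Subset (suc n))) → All (b ≢_) (link B) → All (inside ∷ b ≢_) B
inside-≢ b []                  _        = []
inside-≢ b ((inside  ∷ c) ∷ B) (p ∷ ps) = (p ∘ ∷-injectiveʳ) ∷ inside-≢ b B ps
inside-≢ b ((outside ∷ c) ∷ B) ps       = (λ ()) ∷ inside-≢ b B ps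

outside-≢ : (b : Subset n) (B : List (Subset (suc n))) → All (b ≢_) (deletion B) → All (outside ∷ b ≢_) B
outside-≢ b []                  _        = []
outside-≢ b ((outside ∷ c) ∷ B) (p ∷ ps) = (p ∘ ∷-injectiveʳ) ∷ outside-≢ b B ps
outside-≢ b ((inside  ∷ c) ∷ B) ps       = (λ ()) ∷ outside-≢ b B ps

-- Blocks with different first coordinates differ already; blocks with the same one end up in the
-- same list, where they stay different.
unique-link-deletion : (B : List (Subset (suc n))) → Unique (link B) → Unique (deletion B) → Unique B
unique-link-deletion []                  _        _        = []
unique-link-deletion ((inside  ∷ b) ∷ B) (p ∷ ps) qs       = inside-≢ b B p ∷ unique-link-deletion B ps qs
unique-link-deletion ((outside ∷ b) ∷ B) ps       (q ∷ qs) = outside-≢ b B q ∷ unique-link-deletion B ps qs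

distinct-sound : ∀ n (B : List (Subset n)) → T (distinct n B) → Unique B
distinct-sound n       []            _ = []
distinct-sound n       (b ∷ [])      _ = [] ∷ []
distinct-sound (suc n) B@(_ ∷ _ ∷ _) p =
  unique-link-deletion B (distinct-sound n (link B) (proj₁ (∧-split p)))
    (distinct-sound n (deletion B) (proj₂ (∧-split {distinct n (link B)} p)))

sized : ℕ → Subset n → Bool
sized zero    []            = true
sized (suc k) []            = false
sized k       (outside ∷ b) = sized k b
sized zero    (inside  ∷ b) = false
sized (suc k) (inside  ∷ b) = sized k b

sized-sound : ∀ k (b : Subset n) → T (sized k b) → ∣ b ∣ ≡ k
sized-sound zero    []            _ = refl
sized-sound zero    (outside ∷ b) p = sized-sound zero b p
sized-sound (suc k) (outside ∷ b) p = sized-sound (suc k) b p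
sized-sound (suc k) (inside  ∷ b) p = cong suc (sized-sound k b p)

-- Rotations

rotate : Subset (suc n) → Subset (suc n)
rotate (x ∷ xs) = xs ∷ʳ x

∣∷ʳ∣ : ∀ x (xs : Subset n) → ∣ xs ∷ʳ x ∣ ≡ ∣ x ∷ xs ∣
∣∷ʳ∣ x       []             = refl
∣∷ʳ∣ inside  (inside  ∷ xs) = cong suc (∣∷ʳ∣ inside xs)
∣∷ʳ∣ outside (inside  ∷ xs) = cong suc (∣∷ʳ∣ outside xs)
∣∷ʳ∣ inside  (outside ∷ xs) = ∣∷ʳ∣ inside xs
∣∷ʳ∣ outside (outside ∷ xs) = ∣∷ʳ∣ outside xs

-- Inclusion is a conjunction over the coordinates, so their order is irrelevant. Only the Boolean
-- is compared, because the filter in `blocksContaining` depends on nothing else.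
⊆?-∷ʳ : ∀ x y (p q : Subset n) → does (p ∷ʳ x ⊆? q ∷ʳ y) ≡ does (x ∷ p ⊆? y ∷ q)
⊆?-∷ʳ inside  inside  []            []            = refl
⊆?-∷ʳ inside  outside []            []            = refl
⊆?-∷ʳ outside y       []            []            = refl
⊆?-∷ʳ inside  inside  (outside ∷ p) (_       ∷ q) = ⊆?-∷ʳ inside inside p q
⊆?-∷ʳ inside  outside (outside ∷ p) (_       ∷ q) = ⊆?-∷ʳ inside outside p q
⊆?-∷ʳ outside y       (outside ∷ p) (_       ∷ q) = ⊆?-∷ʳ outside y p q
⊆?-∷ʳ inside  inside  (inside  ∷ p) (inside  ∷ q) = ⊆?-∷ʳ inside inside p q
⊆?-∷ʳ inside  outside (inside  ∷ p) (inside  ∷ q) = ⊆?-∷ʳ inside outside p q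
⊆?-∷ʳ outside y       (inside  ∷ p) (inside  ∷ q) = ⊆?-∷ʳ outside y p q
⊆?-∷ʳ inside  inside  (inside  ∷ p) (outside ∷ q) = refl
⊆?-∷ʳ inside  outside (inside  ∷ p) (outside ∷ q) = refl
⊆?-∷ʳ outside y       (inside  ∷ p) (outside ∷ q) = refl

blocksContaining-rotate : (S : Subset (suc n)) (B : List (Subset (suc n))) →
  blocksContaining (rotate S) (map rotate B) ≡ blocksContaining S B
blocksContaining-rotate S       []            = refl
blocksContaining-rotate (x ∷ S) ((y ∷ b) ∷ B)
  with ih ← blocksContaining-rotate (x ∷ S) B
     | does (S ∷ʳ x ⊆? b ∷ʳ y) | does (x ∷ S ⊆? y ∷ b) | ⊆?-∷ʳ x y S b
... | true  | true  | refl = cong suc ih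
... | false | false | refl = ih

leading : Subset n → ℕ
leading []             = 0
leading (inside  ∷ xs) = 0
leading (outside ∷ xs) = suc (leading xs)

leading-∷ʳ : ∀ x (xs : Subset n) → ∣ xs ∣ ≢ 0 → leading (xs ∷ʳ x) ≡ leading xs
leading-∷ʳ x []             ne = contradiction refl ne
leading-∷ʳ x (inside  ∷ xs) ne = refl
leading-∷ʳ x (outside ∷ xs) ne = cong suc (leading-∷ʳ x xs ne)

-- A nonempty set contains the first point after `leading S` rotations, and `step` carries the
-- property back along them.
rotate-induction : (P : Subset (suc n) → Set) → (∀ S → P (rotate S) → P S) →
  (∀ S → P (inside ∷ S)) → ∀ S → ∣ S ∣ ≢ 0 → P S
rotate-induction P step base S = go (leading S) S ≤-refl
  where
  go : ∀ d S → leading S ≤ d → ∣ S ∣ ≢ 0 → P S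
  go d       (inside  ∷ S) _       _  = base S
  -- Since the set is nonempty, its run of leading `outside` entries ends before the appended
  -- coordinate, so one rotation shortens the run by one.
  go (suc d) (outside ∷ S) (s≤s p) ne = step (outside ∷ S)
    (go d (S ∷ʳ outside) (subst (_≤ d) (sym (leading-∷ʳ outside S ne)) p)
      (ne ∘ trans (sym (∣∷ʳ∣ outside S))))

-- Invariance of block counts under a map of point sets

-- Invariance is required of the counts, not of the list of blocks: it is then additive under
-- concatenation, and the order of the blocks never matters.
record Invariant (f : Subset n → Subset n) (B : List (Subset n)) : Set where
  field
    invariance : ∀ S → blocksContaining (f S) B ≡ blocksContaining S B

open Invariant

blocksContaining-++ : (S : Subset n) (B C : List (Subset n)) →
  blocksContaining S (B ++ C) ≡ blocksContaining S B + blocksContaining S C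
blocksContaining-++ S B C = trans (cong length (filter-++ (S ⊆?_) B C)) (length-++ (filter (S ⊆?_) B))

Invariant-++ : ∀ {f} {B C : List (Subset n)} → Invariant f B → Invariant f C → Invariant f (B ++ C)
Invariant-++ {f = f} {B} {C} p q .invariance S = begin
  blocksContaining (f S) (B ++ C)                       ≡⟨ blocksContaining-++ (f S) B C ⟩
  blocksContaining (f S) B + blocksContaining (f S) C   ≡⟨ cong₂ _+_ (invariance p S) (invariance q S) ⟩
  blocksContaining S B + blocksContaining S C           ≡⟨ blocksContaining-++ S B C ⟨
  blocksContaining S (B ++ C)                           ∎

Invariant-concatMap : ∀ {f} (g : A → List (Subset n)) → (∀ x → Invariant f (g x)) →
  ∀ xs → Invariant f (concatMap g xs)
Invariant-concatMap g p []       .invariance S = refl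
Invariant-concatMap g p (x ∷ xs) = Invariant-++ (p x) (Invariant-concatMap g p xs)

fixHead : (Subset n → Subset n) → Subset (suc n) → Subset (suc n)
fixHead f (x ∷ S) = x ∷ f S

-- Prefixing `y` to the blocks either preserves the count or makes it zero. Which of these happens
-- depends only on the first coordinates, and `fixHead f` leaves them alone.
Invariant-map-∷ : ∀ {f} y {B : List (Subset n)} → Invariant f B → Invariant (fixHead f) (map (y ∷_) B)
Invariant-map-∷ {f = f} y {B} p .invariance (outside ∷ S) =
  trans (restrict (f S) B) (trans (invariance p S) (sym (restrict S B)))
  where
  restrict : ∀ S B → blocksContaining (outside ∷ S) (map (y ∷_) B) ≡ blocksContaining S B
  restrict S []      = refl
  restrict S (b ∷ B) with ih ← restrict S B | does (S ⊆? b)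
  ... | true  = cong suc ih
  ... | false = ih
Invariant-map-∷ {f = f} inside {B} p .invariance (inside ∷ S) =
  trans (restrict (f S) B) (trans (invariance p S) (sym (restrict S B)))
  where
  restrict : (S : Subset n) (B : List (Subset n)) →
    blocksContaining (inside ∷ S) (map (inside ∷_) B) ≡ blocksContaining S B
  restrict S []      = refl
  restrict S (b ∷ B) with ih ← restrict S B | does (S ⊆? b)
  ... | true  = cong suc ih
  ... | false = ih
Invariant-map-∷ {f = f} outside {B} p .invariance (inside ∷ S) = trans (none (f S) B) (sym (none S B))
  where
  none : (S : Subset n) (B : List (Subset n)) → blocksContaining (inside ∷ S) (map (outside ∷_) B) ≡ 0
  none S []      = refl
  none S (_ ∷ B) = none S B

Invariant-link : ∀ {f} {B : List (Subset (suc n))} → Invariant (fixHead f) B → Invariant f (link B)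
Invariant-link {B = B} p .invariance S =
  trans (sym (blocksContaining-inside _ B)) (trans (invariance p (inside ∷ S)) (blocksContaining-inside S B))

Invariant-tail : ∀ {f} {B : List (Subset (suc n))} → Invariant (fixHead f) B → Invariant f (map tail B)
Invariant-tail {B = B} p .invariance S =
  trans (sym (blocksContaining-outside _ B)) (trans (invariance p (outside ∷ S)) (blocksContaining-outside S B))

-- Translates modulo 19 and the reduced covering test

orbit : Subset 19 → List (Subset 19)
orbit b = iterate rotate b 19

-- `rotate` is x ↦ x - 1 on ℤ/19, so its 19th power is the identity. With all 19 coordinates exposed
-- this holds by computation.
orbit-rotate : ∀ b → orbit (rotate b) ≡ iterate rotate (rotate b) 18 ++ b ∷ []
orbit-rotate (_ ∷ _ ∷ _ ∷ _ ∷ _ ∷ _ ∷ _ ∷ _ ∷ _ ∷ _ ∷ _ ∷ _ ∷ _ ∷ _ ∷ _ ∷ _ ∷ _ ∷ _ ∷ _ ∷ []) = refl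

-- Rotating every translate only moves the first one to the end of the list, which does not affect
-- counts; rotating set and blocks together does not affect them either.
orbit-invariant : ∀ b → Invariant rotate (orbit b)
orbit-invariant b .invariance S = begin
  count (b ∷ [] ++ C)          ≡⟨ blocksContaining-++ (rotate S) (b ∷ []) C ⟩
  count (b ∷ []) + count C     ≡⟨ +-comm (count (b ∷ [])) (count C) ⟩
  count C + count (b ∷ [])     ≡⟨ blocksContaining-++ (rotate S) C (b ∷ []) ⟨
  count (C ++ b ∷ [])          ≡⟨ cong count (orbit-rotate b) ⟨
  count (map rotate (orbit b)) ≡⟨ blocksContaining-rotate S (orbit b) ⟩
  blocksContaining S (orbit b) ∎
  where
  count = blocksContaining (rotate S)
  C = iterate rotate (rotate b) 18

-- Any nonempty set can be rotated onto the first point without changing its count, so testing the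
-- link suffices. This saves one point of the set and one coordinate.
link-covers : ∀ t l (B : List (Subset (suc n))) → Invariant rotate B → T (covers n t l (link B)) →
  ∀ S → ∣ S ∣ ≡ suc t → blocksContaining S B ≡ l
link-covers {n} t l B inv c S eq = rotate-induction P step base S (λ z → 0≢1+n (trans (sym z) eq)) eq
  where
  P : Subset (suc n) → Set
  P S = ∣ S ∣ ≡ suc t → blocksContaining S B ≡ l
  step : ∀ S → P (rotate S) → P S
  step (x ∷ S) p eq = trans (sym (invariance inv (x ∷ S))) (p (trans (∣∷ʳ∣ x S) eq))
  base : ∀ S → P (inside ∷ S)
  base S eq = trans (blocksContaining-inside S B) (covers-sound n t l (link B) c S (suc-injective eq))

-- The four tests treat triples with both, only the first, only the second, and neither of the fixed
-- points. Of their 1, 2, 2 or 3 points in ℤ/19 one is taken to be 0, whence the outermost `link`;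
-- 0, 1, 1 or 2 points remain to be chosen among 18.
cyclicCovers : ℕ → List (Subset 21) → Bool
cyclicCovers l B =
  (covers 18 0 l (link (link (link B))) ∧ covers 18 1 l (link (map tail (link B)))) ∧
  (covers 18 1 l (link (link (map tail B))) ∧ covers 18 2 l (link (map tail (map tail B))))

cyclicCovers-sound : ∀ l B → Invariant (fixHead (fixHead rotate)) B → T (cyclicCovers l B) →
  ∀ S → ∣ S ∣ ≡ 3 → blocksContaining S B ≡ l
cyclicCovers-sound l B inv c (x ∷ y ∷ S) ∣S∣≡3
  with c₁ , c₂ ← ∧-split c
  with ∧-split c₁ | ∧-split c₂ | x | y | ∣S∣≡3
... | p , _ | _ | inside  | inside  | eq =
  trans (blocksContaining-inside _ B) (trans (blocksContaining-inside S (link B))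
    (link-covers 0 l _ (Invariant-link (Invariant-link inv)) p S (suc-injective (suc-injective eq))))
... | _ , p | _ | inside  | outside | eq =
  trans (blocksContaining-inside _ B) (trans (blocksContaining-outside S (link B))
    (link-covers 1 l _ (Invariant-tail (Invariant-link inv)) p S (suc-injective eq)))
... | _ | p , _ | outside | inside  | eq =
  trans (blocksContaining-outside _ B) (trans (blocksContaining-inside S (map tail B))
    (link-covers 1 l _ (Invariant-link (Invariant-tail inv)) p S (suc-injective eq)))
... | _ | _ , p | outside | outside | eq =
  trans (blocksContaining-outside _ B) (trans (blocksContaining-outside S (map tail B))
    (link-covers 2 l _ (Invariant-tail (Invariant-tail inv)) p S eq))

-- An entry (k , xs) of a family with ratio c stands for the blocks cⁱ·xs + j with i < k and
-- j ∈ ℤ/19.  The elements of xs sum to 0, so that only multiplications can stabilise xs, and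
-- k is the number of different sets cⁱ·xs.  Sets of size 5, 6, 7 are completed to blocks by both,
-- by each one, and by none of the fixed points, which are the first two coordinates of Subset 21.
record Family : Set where
  field
    ratio : ℕ
    fives sixes sevens : List (ℕ × List ℕ)

indicator : List ℕ → Subset 19
indicator xs = tabulate λ i → any (toℕ i ≡ᵇ_) xs

develop : ℕ → ℕ × List ℕ → List (Subset 19)
develop c (k , xs) = concatMap (orbit ∘ indicator) (iterate (map λ x → c * x % 19) xs k)

extend : Side → Side → List (Subset 19) → List (Subset 21)
extend x y B = map (x ∷_) (map (y ∷_) B)

blocks : Family → List (Subset 21)
blocks F =
  extend inside inside (developAll fives) ++ extend inside outside (developAll sixes) ++
  extend outside inside (developAll sixes) ++ extend outside outside (developAll sevens)
  where
  open Family F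
  developAll = concatMap (develop ratio)

blocks-invariant : ∀ F → Invariant (fixHead (fixHead rotate)) (blocks F)
blocks-invariant F =
  Invariant-++ (extended inside inside fives) (Invariant-++ (extended inside outside sixes)
    (Invariant-++ (extended outside inside sixes) (extended outside outside sevens)))
  where
  open Family F
  extended : ∀ x y bs → Invariant (fixHead (fixHead rotate)) (extend x y (concatMap (develop ratio) bs))
  extended x y bs = Invariant-map-∷ x (Invariant-map-∷ y (Invariant-concatMap (develop ratio)
    (λ (k , xs) → Invariant-concatMap (orbit ∘ indicator) (orbit-invariant ∘ indicator) (iterate _ xs k)) bs))

isDesign? : ℕ × Family → Bool
isDesign? (l , F) = all (sized 7) (blocks F) ∧ cyclicCovers l (blocks F)

isDesign?-sound : ∀ l F → T (isDesign? (l , F)) → IsDesign 3 21 7 l (blocks F)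
isDesign?-sound l F p with q , r ← ∧-split p =
  All.map (λ {b} → sized-sound 7 b) (All.all⁺ (sized 7) (blocks F) q) ,
  cyclicCovers-sound l (blocks F) (blocks-invariant F) r

-- Unions of disjoint designs

subsetSums : List ℕ → List ℕ
subsetSums []       = 0 ∷ []
subsetSums (l ∷ ls) = subsetSums ls ++ map (l +_) (subsetSums ls)

AllPairs-resp-⊑ : {R : Rel A 0ℓ} {xs ys : List A} → xs ⊑ ys → AllPairs R ys → AllPairs R xs
AllPairs-resp-⊑ []         []       = []
AllPairs-resp-⊑ (skip _ τ) (_ ∷ ps) = AllPairs-resp-⊑ τ ps
AllPairs-resp-⊑ (refl ∷ τ) (p ∷ ps) = All-resp-⊆ τ p ∷ AllPairs-resp-⊑ τ ps

module _ {t v k : ℕ} where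

  IsDesign-++ : ∀ {l m B C} → IsDesign t v k l B → IsDesign t v k m C → IsDesign t v k (l + m) (B ++ C)
  IsDesign-++ {B = B} {C} (p , q) (p′ , q′) =
    All.++⁺ p p′ , λ S eq → trans (blocksContaining-++ S B C) (cong₂ _+_ (q S eq) (q′ S eq))

  -- The recursion of `subsetSums` records which designs are chosen. The union is kept as a sublist
  -- of the concatenation of all designs, so that one check of that list for repetitions makes every
  -- such union simple.
  unionDesign : ∀ ds → All (λ (l , B) → IsDesign t v k l B) ds → ∀ {l} → l ∈ subsetSums (map proj₁ ds) →
    ∃[ B ] (IsDesign t v k l B × B ⊑ concat (map proj₂ ds))
  unionDesign []             []       (here refl) = [] , ([] , λ _ _ → refl) , []
  unionDesign ((m , C) ∷ ds) (p ∷ ps) l∈ with ∈-++⁻ (subsetSums (map proj₁ ds)) l∈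
  ... | inj₁ l∈′ with B , q , τ ← unionDesign ds ps l∈′ = B , q , ++⁺ˡ C τ
  ... | inj₂ l∈′ with _ , l∈″ , refl ← ∈-map⁻ (m +_) l∈′ with B , q , τ ← unionDesign ds ps l∈″ =
    C ++ B , IsDesign-++ p q , ++⁺ ⊆-refl τ

developed : List (ℕ × Family) → List (ℕ × List (Subset 21))
developed = map λ (l , F) → l , blocks F

-- The test enters as an equation with `true`, which evaluation settles by `refl` for a concrete
-- list of families.
developed-designs : ∀ Fs → all isDesign? Fs ≡ true →
  All (λ (l , B) → IsDesign 3 21 7 l B) (developed Fs)
developed-designs Fs eq = All.map⁺ (All.map (λ {(l , F)} → isDesign?-sound l F)
  (All.all⁺ isDesign? Fs (Equivalence.from T-≡ eq)))

developed-unique : ∀ Fs → distinct 21 (concat (map proj₂ (developed Fs))) ≡ true →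
  Unique (concat (map proj₂ (developed Fs)))
developed-unique Fs eq = distinct-sound 21 _ (Equivalence.from T-≡ eq)

simpleDesign : ∀ Fs → All (λ (l , B) → IsDesign 3 21 7 l B) (developed Fs) →
  Unique (concat (map proj₂ (developed Fs))) →
  ∀ {l} → l ∈ subsetSums (map proj₁ (developed Fs)) → SimpleDesignExists 3 21 7 l
simpleDesign Fs designs unique l∈ with B , design , τ ← unionDesign (developed Fs) designs l∈ =
  B , design , AllPairs-resp-⊑ τ unique

-- The base blocks of the eight designs

family₁ : Family
family₁ = record
  -- 8 has order 6 modulo 19, with 8² = 7 and 8³ = -1.
  { ratio  = 8
  ; fives  = (6 , 1 ∷ 5 ∷ 6 ∷ 10 ∷ 16 ∷ []) ∷ []
  ; sixes  = (6 , 0 ∷ 1 ∷ 2 ∷ 4 ∷ 5 ∷ 7 ∷ []) ∷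
             -- Stable under multiplication by 7, of order 3, which leaves two different multiples.
             (2 , 2 ∷ 3 ∷ 10 ∷ 13 ∷ 14 ∷ 15 ∷ []) ∷
             (6 , 0 ∷ 1 ∷ 2 ∷ 7 ∷ 13 ∷ 15 ∷ []) ∷ []
  ; sevens = (6 , 1 ∷ 2 ∷ 4 ∷ 7 ∷ 12 ∷ 15 ∷ 16 ∷ []) ∷
             (6 , 2 ∷ 3 ∷ 4 ∷ 9 ∷ 10 ∷ 13 ∷ 16 ∷ []) ∷
             (6 , 0 ∷ 1 ∷ 5 ∷ 6 ∷ 13 ∷ 15 ∷ 17 ∷ []) ∷
             (2 , 0 ∷ 2 ∷ 3 ∷ 4 ∷ 6 ∷ 9 ∷ 14 ∷ []) ∷
             (6 , 1 ∷ 2 ∷ 5 ∷ 7 ∷ 11 ∷ 15 ∷ 16 ∷ []) ∷ []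
  }

family₂ : Family
family₂ = record
  { ratio  = 8
  ; fives  = (6 , 1 ∷ 2 ∷ 10 ∷ 12 ∷ 13 ∷ []) ∷ []
  ; sixes  = (6 , 0 ∷ 2 ∷ 4 ∷ 8 ∷ 10 ∷ 14 ∷ []) ∷
             (2 , 1 ∷ 4 ∷ 6 ∷ 7 ∷ 9 ∷ 11 ∷ []) ∷
             (6 , 0 ∷ 2 ∷ 4 ∷ 7 ∷ 11 ∷ 14 ∷ []) ∷ []
  ; sevens = (6 , 2 ∷ 4 ∷ 5 ∷ 8 ∷ 11 ∷ 13 ∷ 14 ∷ []) ∷
             (6 , 1 ∷ 4 ∷ 6 ∷ 7 ∷ 8 ∷ 13 ∷ 18 ∷ []) ∷
             (6 , 0 ∷ 2 ∷ 7 ∷ 10 ∷ 11 ∷ 12 ∷ 15 ∷ []) ∷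
             (2 , 0 ∷ 4 ∷ 6 ∷ 8 ∷ 9 ∷ 12 ∷ 18 ∷ []) ∷
             (6 , 2 ∷ 3 ∷ 4 ∷ 10 ∷ 11 ∷ 13 ∷ 14 ∷ []) ∷ []
  }

family₃ : Family
family₃ = record
  -- 2 is a primitive root modulo 19.
  { ratio  = 2
  -- Stable under -1 = 2⁹, hence 9 different multiples.
  ; fives  = (9 , 0 ∷ 1 ∷ 2 ∷ 17 ∷ 18 ∷ []) ∷ []
  -- The subgroup of order 6 generated by 8 = 2³; its multiples are its three cosets.
  ; sixes  = (3 , 1 ∷ 7 ∷ 8 ∷ 11 ∷ 12 ∷ 18 ∷ []) ∷
             (18 , 1 ∷ 3 ∷ 8 ∷ 12 ∷ 15 ∷ 18 ∷ []) ∷ []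
  ; sevens = (3 , 0 ∷ 1 ∷ 7 ∷ 8 ∷ 11 ∷ 12 ∷ 18 ∷ []) ∷
             (18 , 1 ∷ 2 ∷ 4 ∷ 5 ∷ 14 ∷ 15 ∷ 16 ∷ []) ∷
             (18 , 1 ∷ 2 ∷ 4 ∷ 7 ∷ 10 ∷ 15 ∷ 18 ∷ []) ∷ []
  }

family₄ : Family
family₄ = record
  { ratio  = 2
  ; fives  = (18 , 1 ∷ 2 ∷ 6 ∷ 11 ∷ 18 ∷ []) ∷ []
  -- Stable under 7 = 2⁶, hence 6 different multiples.
  ; sixes  = (6 , 1 ∷ 2 ∷ 3 ∷ 7 ∷ 11 ∷ 14 ∷ []) ∷
             (18 , 0 ∷ 1 ∷ 4 ∷ 5 ∷ 11 ∷ 17 ∷ []) ∷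
             (18 , 1 ∷ 2 ∷ 12 ∷ 13 ∷ 14 ∷ 15 ∷ []) ∷ []
  ; sevens = (6 , 0 ∷ 1 ∷ 4 ∷ 6 ∷ 7 ∷ 9 ∷ 11 ∷ []) ∷
             (18 , 0 ∷ 1 ∷ 2 ∷ 9 ∷ 14 ∷ 15 ∷ 16 ∷ []) ∷
             (18 , 1 ∷ 2 ∷ 3 ∷ 5 ∷ 6 ∷ 8 ∷ 13 ∷ []) ∷
             (18 , 1 ∷ 2 ∷ 3 ∷ 6 ∷ 12 ∷ 15 ∷ 18 ∷ []) ∷
             (18 , 1 ∷ 2 ∷ 5 ∷ 8 ∷ 11 ∷ 13 ∷ 17 ∷ []) ∷ []
  }

family₅ : Family
family₅ = record
  { ratio  = 2
  ; fives  = (9 , 0 ∷ 1 ∷ 3 ∷ 16 ∷ 18 ∷ []) ∷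
             (18 , 0 ∷ 1 ∷ 6 ∷ 14 ∷ 17 ∷ []) ∷ []
  ; sixes  = (9 , 1 ∷ 3 ∷ 7 ∷ 12 ∷ 16 ∷ 18 ∷ []) ∷
             (18 , 1 ∷ 2 ∷ 3 ∷ 5 ∷ 13 ∷ 14 ∷ []) ∷
             (18 , 1 ∷ 2 ∷ 4 ∷ 5 ∷ 12 ∷ 14 ∷ []) ∷
             (18 , 1 ∷ 2 ∷ 5 ∷ 7 ∷ 8 ∷ 15 ∷ []) ∷ []
  ; sevens = (9 , 0 ∷ 1 ∷ 2 ∷ 4 ∷ 15 ∷ 17 ∷ 18 ∷ []) ∷
             (18 , 0 ∷ 1 ∷ 2 ∷ 3 ∷ 4 ∷ 11 ∷ 17 ∷ []) ∷
             (18 , 0 ∷ 1 ∷ 2 ∷ 6 ∷ 14 ∷ 16 ∷ 18 ∷ []) ∷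
             (18 , 0 ∷ 1 ∷ 2 ∷ 12 ∷ 13 ∷ 14 ∷ 15 ∷ []) ∷
             (18 , 1 ∷ 2 ∷ 3 ∷ 4 ∷ 5 ∷ 11 ∷ 12 ∷ []) ∷
             (18 , 1 ∷ 2 ∷ 3 ∷ 6 ∷ 13 ∷ 14 ∷ 18 ∷ []) ∷
             (18 , 1 ∷ 2 ∷ 3 ∷ 8 ∷ 10 ∷ 15 ∷ 18 ∷ []) ∷ []
  }

family₆ : Family
family₆ = record
  { ratio  = 2
  ; fives  = (9 , 0 ∷ 1 ∷ 4 ∷ 15 ∷ 18 ∷ []) ∷
             (9 , 0 ∷ 1 ∷ 7 ∷ 12 ∷ 18 ∷ []) ∷
             (18 , 1 ∷ 2 ∷ 5 ∷ 12 ∷ 18 ∷ []) ∷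
             (18 , 1 ∷ 2 ∷ 6 ∷ 14 ∷ 15 ∷ []) ∷ []
  ; sixes  = (9 , 1 ∷ 2 ∷ 4 ∷ 15 ∷ 17 ∷ 18 ∷ []) ∷
             (9 , 1 ∷ 2 ∷ 7 ∷ 12 ∷ 17 ∷ 18 ∷ []) ∷
             (18 , 0 ∷ 1 ∷ 2 ∷ 8 ∷ 12 ∷ 15 ∷ []) ∷
             (18 , 0 ∷ 1 ∷ 3 ∷ 4 ∷ 12 ∷ 18 ∷ []) ∷
             (18 , 1 ∷ 2 ∷ 3 ∷ 6 ∷ 11 ∷ 15 ∷ []) ∷
             (18 , 1 ∷ 2 ∷ 3 ∷ 6 ∷ 12 ∷ 14 ∷ []) ∷
             (18 , 1 ∷ 2 ∷ 6 ∷ 8 ∷ 9 ∷ 12 ∷ []) ∷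
             (18 , 1 ∷ 3 ∷ 4 ∷ 5 ∷ 9 ∷ 16 ∷ []) ∷ []
  ; sevens = (9 , 0 ∷ 1 ∷ 2 ∷ 3 ∷ 16 ∷ 17 ∷ 18 ∷ []) ∷
             (9 , 0 ∷ 1 ∷ 2 ∷ 5 ∷ 14 ∷ 17 ∷ 18 ∷ []) ∷
             (18 , 0 ∷ 1 ∷ 2 ∷ 3 ∷ 4 ∷ 10 ∷ 18 ∷ []) ∷
             (18 , 0 ∷ 1 ∷ 2 ∷ 5 ∷ 6 ∷ 7 ∷ 17 ∷ []) ∷
             (18 , 0 ∷ 1 ∷ 2 ∷ 5 ∷ 7 ∷ 8 ∷ 15 ∷ []) ∷
             (18 , 1 ∷ 2 ∷ 3 ∷ 4 ∷ 5 ∷ 6 ∷ 17 ∷ []) ∷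
             (18 , 1 ∷ 2 ∷ 3 ∷ 4 ∷ 5 ∷ 9 ∷ 14 ∷ []) ∷
             (18 , 1 ∷ 2 ∷ 3 ∷ 4 ∷ 13 ∷ 16 ∷ 18 ∷ []) ∷
             (18 , 1 ∷ 2 ∷ 3 ∷ 6 ∷ 14 ∷ 15 ∷ 16 ∷ []) ∷
             (18 , 1 ∷ 2 ∷ 3 ∷ 7 ∷ 12 ∷ 14 ∷ 18 ∷ []) ∷
             (18 , 1 ∷ 2 ∷ 3 ∷ 9 ∷ 11 ∷ 15 ∷ 16 ∷ []) ∷
             (18 , 1 ∷ 2 ∷ 4 ∷ 7 ∷ 10 ∷ 16 ∷ 17 ∷ []) ∷
             (18 , 1 ∷ 2 ∷ 5 ∷ 6 ∷ 7 ∷ 8 ∷ 9 ∷ []) ∷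
             (18 , 1 ∷ 2 ∷ 5 ∷ 9 ∷ 11 ∷ 14 ∷ 15 ∷ []) ∷ []
  }

family₇ : Family
family₇ = record
  { ratio  = 2
  ; fives  = (18 , 0 ∷ 1 ∷ 2 ∷ 3 ∷ 13 ∷ []) ∷
             (18 , 1 ∷ 2 ∷ 3 ∷ 6 ∷ 7 ∷ []) ∷
             (18 , 1 ∷ 2 ∷ 5 ∷ 13 ∷ 17 ∷ []) ∷
             (18 , 1 ∷ 2 ∷ 7 ∷ 11 ∷ 17 ∷ []) ∷
             (18 , 1 ∷ 2 ∷ 7 ∷ 12 ∷ 16 ∷ []) ∷
             (18 , 1 ∷ 3 ∷ 8 ∷ 12 ∷ 14 ∷ []) ∷ []
  ; sixes  = (9 , 1 ∷ 2 ∷ 3 ∷ 16 ∷ 17 ∷ 18 ∷ []) ∷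
             (9 , 1 ∷ 2 ∷ 5 ∷ 14 ∷ 17 ∷ 18 ∷ []) ∷
             (9 , 1 ∷ 2 ∷ 6 ∷ 13 ∷ 17 ∷ 18 ∷ []) ∷
             (9 , 1 ∷ 3 ∷ 5 ∷ 14 ∷ 16 ∷ 18 ∷ []) ∷
             (18 , 0 ∷ 1 ∷ 2 ∷ 3 ∷ 14 ∷ 18 ∷ []) ∷
             (18 , 0 ∷ 1 ∷ 2 ∷ 4 ∷ 13 ∷ 18 ∷ []) ∷
             (18 , 0 ∷ 1 ∷ 2 ∷ 4 ∷ 15 ∷ 16 ∷ []) ∷
             (18 , 0 ∷ 1 ∷ 2 ∷ 5 ∷ 13 ∷ 17 ∷ []) ∷
             (18 , 0 ∷ 1 ∷ 2 ∷ 9 ∷ 11 ∷ 15 ∷ []) ∷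
             (18 , 0 ∷ 1 ∷ 3 ∷ 4 ∷ 13 ∷ 17 ∷ []) ∷
             (18 , 0 ∷ 1 ∷ 3 ∷ 4 ∷ 14 ∷ 16 ∷ []) ∷
             (18 , 1 ∷ 2 ∷ 3 ∷ 5 ∷ 11 ∷ 16 ∷ []) ∷
             (18 , 1 ∷ 2 ∷ 3 ∷ 6 ∷ 9 ∷ 17 ∷ []) ∷
             (18 , 1 ∷ 2 ∷ 4 ∷ 5 ∷ 10 ∷ 16 ∷ []) ∷
             (18 , 1 ∷ 2 ∷ 4 ∷ 5 ∷ 11 ∷ 15 ∷ []) ∷
             (18 , 1 ∷ 2 ∷ 6 ∷ 15 ∷ 16 ∷ 17 ∷ []) ∷ []
  ; sevens = (9 , 0 ∷ 1 ∷ 2 ∷ 6 ∷ 13 ∷ 17 ∷ 18 ∷ []) ∷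
             (9 , 0 ∷ 1 ∷ 3 ∷ 4 ∷ 15 ∷ 16 ∷ 18 ∷ []) ∷
             (18 , 0 ∷ 1 ∷ 2 ∷ 3 ∷ 5 ∷ 10 ∷ 17 ∷ []) ∷
             (18 , 0 ∷ 1 ∷ 2 ∷ 3 ∷ 5 ∷ 11 ∷ 16 ∷ []) ∷
             (18 , 0 ∷ 1 ∷ 2 ∷ 3 ∷ 6 ∷ 8 ∷ 18 ∷ []) ∷
             (18 , 0 ∷ 1 ∷ 2 ∷ 3 ∷ 7 ∷ 8 ∷ 17 ∷ []) ∷
             (18 , 0 ∷ 1 ∷ 2 ∷ 3 ∷ 8 ∷ 9 ∷ 15 ∷ []) ∷
             (18 , 0 ∷ 1 ∷ 2 ∷ 4 ∷ 5 ∷ 11 ∷ 15 ∷ []) ∷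
             (18 , 0 ∷ 1 ∷ 2 ∷ 6 ∷ 15 ∷ 16 ∷ 17 ∷ []) ∷
             (18 , 0 ∷ 1 ∷ 2 ∷ 11 ∷ 12 ∷ 13 ∷ 18 ∷ []) ∷
             (18 , 0 ∷ 1 ∷ 2 ∷ 11 ∷ 12 ∷ 14 ∷ 17 ∷ []) ∷
             (18 , 0 ∷ 1 ∷ 3 ∷ 4 ∷ 5 ∷ 9 ∷ 16 ∷ []) ∷
             (18 , 1 ∷ 2 ∷ 3 ∷ 4 ∷ 5 ∷ 10 ∷ 13 ∷ []) ∷
             (18 , 1 ∷ 2 ∷ 3 ∷ 5 ∷ 13 ∷ 15 ∷ 18 ∷ []) ∷
             (18 , 1 ∷ 2 ∷ 3 ∷ 6 ∷ 7 ∷ 8 ∷ 11 ∷ []) ∷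
             (18 , 1 ∷ 2 ∷ 3 ∷ 6 ∷ 13 ∷ 15 ∷ 17 ∷ []) ∷
             (18 , 1 ∷ 2 ∷ 3 ∷ 8 ∷ 11 ∷ 15 ∷ 17 ∷ []) ∷
             (18 , 1 ∷ 2 ∷ 3 ∷ 8 ∷ 12 ∷ 15 ∷ 16 ∷ []) ∷
             (18 , 1 ∷ 2 ∷ 3 ∷ 9 ∷ 10 ∷ 15 ∷ 17 ∷ []) ∷
             (18 , 1 ∷ 2 ∷ 3 ∷ 9 ∷ 12 ∷ 13 ∷ 17 ∷ []) ∷
             (18 , 1 ∷ 2 ∷ 4 ∷ 5 ∷ 7 ∷ 9 ∷ 10 ∷ []) ∷
             (18 , 1 ∷ 2 ∷ 4 ∷ 5 ∷ 12 ∷ 15 ∷ 18 ∷ []) ∷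
             (18 , 1 ∷ 2 ∷ 4 ∷ 7 ∷ 9 ∷ 16 ∷ 18 ∷ []) ∷
             (18 , 1 ∷ 2 ∷ 5 ∷ 8 ∷ 12 ∷ 14 ∷ 15 ∷ []) ∷
             (18 , 1 ∷ 2 ∷ 5 ∷ 9 ∷ 11 ∷ 13 ∷ 16 ∷ []) ∷
             (18 , 1 ∷ 2 ∷ 6 ∷ 7 ∷ 8 ∷ 15 ∷ 18 ∷ []) ∷
             (18 , 1 ∷ 2 ∷ 6 ∷ 8 ∷ 12 ∷ 13 ∷ 15 ∷ []) ∷ []
  }

family₈ : Family
family₈ = record
  { ratio  = 2
  ; fives  = (18 , 0 ∷ 1 ∷ 4 ∷ 5 ∷ 9 ∷ []) ∷
             (18 , 1 ∷ 2 ∷ 3 ∷ 4 ∷ 9 ∷ []) ∷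
             (18 , 1 ∷ 2 ∷ 3 ∷ 14 ∷ 18 ∷ []) ∷
             (18 , 1 ∷ 2 ∷ 4 ∷ 13 ∷ 18 ∷ []) ∷
             (18 , 1 ∷ 2 ∷ 4 ∷ 14 ∷ 17 ∷ []) ∷
             (18 , 1 ∷ 2 ∷ 9 ∷ 11 ∷ 15 ∷ []) ∷ []
  ; sixes  = (9 , 1 ∷ 2 ∷ 8 ∷ 11 ∷ 17 ∷ 18 ∷ []) ∷
             (9 , 1 ∷ 3 ∷ 4 ∷ 15 ∷ 16 ∷ 18 ∷ []) ∷
             (18 , 0 ∷ 1 ∷ 2 ∷ 3 ∷ 15 ∷ 17 ∷ []) ∷
             (18 , 0 ∷ 1 ∷ 2 ∷ 8 ∷ 13 ∷ 14 ∷ []) ∷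
             (18 , 0 ∷ 1 ∷ 3 ∷ 8 ∷ 12 ∷ 14 ∷ []) ∷
             (18 , 1 ∷ 2 ∷ 3 ∷ 5 ∷ 10 ∷ 17 ∷ []) ∷
             (18 , 1 ∷ 2 ∷ 3 ∷ 8 ∷ 9 ∷ 15 ∷ []) ∷
             (18 , 1 ∷ 2 ∷ 3 ∷ 8 ∷ 10 ∷ 14 ∷ []) ∷
             (18 , 1 ∷ 2 ∷ 3 ∷ 8 ∷ 11 ∷ 13 ∷ []) ∷
             (18 , 1 ∷ 2 ∷ 3 ∷ 9 ∷ 10 ∷ 13 ∷ []) ∷
             (18 , 1 ∷ 2 ∷ 3 ∷ 9 ∷ 11 ∷ 12 ∷ []) ∷
             (18 , 1 ∷ 2 ∷ 4 ∷ 5 ∷ 9 ∷ 17 ∷ []) ∷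
             (18 , 1 ∷ 2 ∷ 4 ∷ 7 ∷ 9 ∷ 15 ∷ []) ∷
             (18 , 1 ∷ 2 ∷ 5 ∷ 6 ∷ 9 ∷ 15 ∷ []) ∷
             (18 , 1 ∷ 2 ∷ 7 ∷ 8 ∷ 9 ∷ 11 ∷ []) ∷ []
  ; sevens = (9 , 0 ∷ 1 ∷ 2 ∷ 7 ∷ 12 ∷ 17 ∷ 18 ∷ []) ∷
             (9 , 0 ∷ 1 ∷ 2 ∷ 8 ∷ 11 ∷ 17 ∷ 18 ∷ []) ∷
             (18 , 0 ∷ 1 ∷ 2 ∷ 3 ∷ 4 ∷ 12 ∷ 16 ∷ []) ∷
             (18 , 0 ∷ 1 ∷ 2 ∷ 3 ∷ 6 ∷ 11 ∷ 15 ∷ []) ∷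
             (18 , 0 ∷ 1 ∷ 2 ∷ 3 ∷ 7 ∷ 10 ∷ 15 ∷ []) ∷
             (18 , 0 ∷ 1 ∷ 2 ∷ 3 ∷ 8 ∷ 11 ∷ 13 ∷ []) ∷
             (18 , 0 ∷ 1 ∷ 2 ∷ 3 ∷ 9 ∷ 11 ∷ 12 ∷ []) ∷
             (18 , 0 ∷ 1 ∷ 2 ∷ 4 ∷ 5 ∷ 9 ∷ 17 ∷ []) ∷
             (18 , 0 ∷ 1 ∷ 2 ∷ 4 ∷ 5 ∷ 12 ∷ 14 ∷ []) ∷
             (18 , 0 ∷ 1 ∷ 2 ∷ 5 ∷ 6 ∷ 11 ∷ 13 ∷ []) ∷
             (18 , 0 ∷ 1 ∷ 2 ∷ 5 ∷ 7 ∷ 11 ∷ 12 ∷ []) ∷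
             (18 , 0 ∷ 1 ∷ 2 ∷ 5 ∷ 15 ∷ 16 ∷ 18 ∷ []) ∷
             (18 , 0 ∷ 1 ∷ 2 ∷ 6 ∷ 8 ∷ 9 ∷ 12 ∷ []) ∷
             (18 , 0 ∷ 1 ∷ 3 ∷ 8 ∷ 12 ∷ 15 ∷ 18 ∷ []) ∷
             (18 , 1 ∷ 2 ∷ 3 ∷ 4 ∷ 12 ∷ 17 ∷ 18 ∷ []) ∷
             (18 , 1 ∷ 2 ∷ 3 ∷ 4 ∷ 14 ∷ 15 ∷ 18 ∷ []) ∷
             (18 , 1 ∷ 2 ∷ 3 ∷ 4 ∷ 14 ∷ 16 ∷ 17 ∷ []) ∷
             (18 , 1 ∷ 2 ∷ 3 ∷ 5 ∷ 7 ∷ 9 ∷ 11 ∷ []) ∷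
             (18 , 1 ∷ 2 ∷ 3 ∷ 6 ∷ 12 ∷ 16 ∷ 17 ∷ []) ∷
             (18 , 1 ∷ 2 ∷ 3 ∷ 7 ∷ 10 ∷ 16 ∷ 18 ∷ []) ∷
             (18 , 1 ∷ 2 ∷ 3 ∷ 7 ∷ 12 ∷ 15 ∷ 17 ∷ []) ∷
             (18 , 1 ∷ 2 ∷ 3 ∷ 8 ∷ 12 ∷ 13 ∷ 18 ∷ []) ∷
             (18 , 1 ∷ 2 ∷ 3 ∷ 9 ∷ 12 ∷ 14 ∷ 16 ∷ []) ∷
             (18 , 1 ∷ 2 ∷ 4 ∷ 9 ∷ 11 ∷ 13 ∷ 17 ∷ []) ∷
             (18 , 1 ∷ 2 ∷ 5 ∷ 6 ∷ 8 ∷ 17 ∷ 18 ∷ []) ∷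
             (18 , 1 ∷ 2 ∷ 5 ∷ 7 ∷ 9 ∷ 16 ∷ 17 ∷ []) ∷
             (18 , 1 ∷ 2 ∷ 5 ∷ 8 ∷ 11 ∷ 12 ∷ 18 ∷ []) ∷ []
  }

-- A design with index λ has 19λ/5 blocks through both fixed points, 133λ/15 through a given one
-- only and 247λ/15 through neither. Accordingly the numbers k in `fives`, `sixes` and `sevens` of
-- each family add up to λ/5, 7λ/15 and 13λ/15.
families : List (ℕ × Family)
families =
  (30 , family₁) ∷ (30 , family₂) ∷ (45 , family₃) ∷ (90 , family₄) ∷
  (135 , family₅) ∷ (270 , family₆) ∷ (540 , family₇) ∷ (540 , family₈) ∷ []

families-designs : All (λ (l , B) → IsDesign 3 21 7 l B) (developed families)
families-designs = developed-designs families refl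

-- For the joint list, absence of repetitions comprises the simplicity of each design and the
-- disjointness of any two.
families-unique : Unique (concat (map proj₂ (developed families)))
families-unique = developed-unique families refl

multiples : ∀ {m} → m < 103 → 2 ≤ m → 15 * m ∈ subsetSums (map proj₁ (developed families))
multiples = from-yes (allUpTo?
  (λ m → 2 ≤? m →-dec _∈?_ _≟_ (15 * m) (subsetSums (map proj₁ (developed families)))) 103)

theorem5 : (m : ℕ) → 2 ≤ m → m ≤ 102 → SimpleDesignExists 3 21 7 (15 * m)
theorem5 m 2≤m m≤102 = simpleDesign families families-designs families-unique (multiples (s≤s m≤102) 2≤m)
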